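{- Let $i\ge 3$ and $k\ge 3$ be integers, let $p$ be a nonnegative integer, and put $r=\lfloor (F_i-1)/F_k\rfloor$. If $r\ge p$, then $$n_p(F_i,F_{i+2},F_{i+k})=\tfrac12\bigl((F_i+2pF_k-1)F_{i+2}-F_i+1\bigr)-\tfrac12\bigl(2rF_i-(r+p+1)(r-p)F_k\bigr)F_{k-2}.$$
   Context: Fibonacci numbers: $F_0=0$, $F_1=1$, $F_n=F_{n-1}+F_{n-2}$. For positive integers $a_1,\dots,a_l$ with $\gcd(a_1,\dots,a_l)=1$ and an integer $n$, let $d(n;a_1,\dots,a_l)$ be the number of tuples $(x_1,\dots,x_l)$ of nonnegative integers with $a_1x_1+\dots+a_lx_l=n$. For a nonnegative integer $p$, the $p$-Sylvester number $n_p(a_1,\dots,a_l)$ is the number of nonnegative integers $n$ with $d(n;a_1,\dots,a_l)\le p$. -}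

module Defs where

open import Data.List.Base using (List; length)
open import Data.List.Membership.Propositional using (_∈_)
open import Data.List.Relation.Unary.Unique.Propositional using (Unique)
open import Data.Nat.Base using (ℕ; zero; suc; _+_; _*_; _≤_; NonZero; s≤s; ≢-nonZero⁻¹; ≢-nonZero)
open import Data.Nat.Properties using (m+n≡0⇒m≡0)
open import Data.Product.Base using (_×_; ∃-syntax)
open import Data.Vec.Base using (Vec; sum; zipWith)
open import Function.Bundles using (_⇔_)
open import Level using (Level; _⊔_)
open import Relation.Binary.PropositionalEquality using (_≡_)

private
  variable
    a p : Level
    l : ℕ

fib : ℕ → ℕ
fib 0 = 0
fib 1 = 1
fib (suc (suc n)) = fib (suc n) + fib n

fib-suc-nonZero : ∀ n → NonZero (fib (suc n))
fib-suc-nonZero zero = _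
fib-suc-nonZero (suc n) =
  ≢-nonZero λ eq →
    ≢-nonZero⁻¹ (fib (suc n)) {{fib-suc-nonZero n}} (m+n≡0⇒m≡0 (fib (suc n)) eq)

fib-nonZero : ∀ {m n} → suc m ≤ n → NonZero (fib n)
fib-nonZero {n = suc n} (s≤s _) = fib-suc-nonZero n

-- { x | P x } is finite with exactly c elements: a duplicate-free list of
-- length c has precisely the elements satisfying P as its members.  Such a c
-- is unique when it exists.
HasCardinality : {A : Set a} → (A → Set p) → ℕ → Set (a ⊔ p)
HasCardinality P c =
  ∃[ xs ] Unique xs × (∀ x → x ∈ xs ⇔ P x) × length xs ≡ c

infix 7 _·_

_·_ : Vec ℕ l → Vec ℕ l → ℕ
as · xs = sum (zipWith _*_ as xs)

-- d(n; a₁, …, aₗ) = c.  When all aᵢ are positive, such a c exists.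
Denumerant : ℕ → Vec ℕ l → ℕ → Set
Denumerant n as c = HasCardinality (λ xs → as · xs ≡ n) c

-- n_p(a₁, …, aₗ) = N.  When all aᵢ are positive and coprime as a family,
-- such an N exists.
SylvesterNumber : ℕ → Vec ℕ l → ℕ → Set
SylvesterNumber p as N =
  HasCardinality (λ n → ∃[ c ] Denumerant n as c × c ≤ p) N

{-# OPTIONS --safe #-}

-- Write A = F_i, B = F_{i+2}, C = F_{i+k}, q = F_k, s = F_{k-2}, so that C + sA = qB.
-- If n = jB + mA with 0 ≤ j < A, then Ax + By + Cz = n amounts to y + qz = j + tA and
-- x = m − (tB − sz) for some t ≥ 0.  Hence d(n) counts the pairs (t, z) with
-- qz ≤ j + tA whose threshold tB − sz is at most m, and d(n) ≤ p means that m lies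
-- below the (p+1)-st smallest threshold.  As pq ≤ A and sA ≤ C, the p + 1 smallest
-- thresholds occur for t ≤ 1, where they are taken in the order of decreasing z,
-- first with t = 0 and then with t = 1.  Summing over j leaves ∑ ⌊jB/A⌋ and ∑ ⌊j/q⌋.

module Submission where

open import Defs
open import Data.Nat.Base as ℕ using (ℕ; zero; suc; z≤n; s≤s; z<s; s<s; s≤s⁻¹; NonZero; _≤_; _<_; _∸_)
open import Data.Nat.DivMod as ℕ using ()
open import Data.Nat.Coprimality using (Coprime)
open import Data.Nat.Properties as ℕ using ()
open import Data.Product.Base using (_×_; _,_; proj₁; proj₂; ∃-syntax)
open import Data.Vec.Base using (Vec; _∷_; [])
open import Relation.Binary.PropositionalEquality
  using (_≡_; _≢_; refl; sym; trans; cong; cong₂; subst; module ≡-Reasoning)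

-- The relation `C + s * A ≡ q * B` trades one copy of C for q copies of B with s copies of A taken
-- back. Thresholds can therefore be negative, and the comparisons below have their subtracted terms
-- moved to the other side. From sA ≤ C follows 2sA ≤ qB. A pair with qz ≤ j + tA < (t + 1)A thus
-- has sz ≤ (t + 1)B/2, and its threshold is at least (t - 1)B/2. So no pair with t ≥ 1 lies below a
-- pair with t = 0, but this bound alone does not separate t ≥ 2 from t = 1. That separation is
-- needed only up to position p. If the pair at position p has t = 1, then pq ≤ A forces qz ≥ j,
-- which leaves a competitor with t ≥ 2 too little extra z to fall below it. Equal thresholds need
-- no tie-breaking: the upper bound on the number of solutions works with a strict comparison, the
-- lower bound with a weak one.

module Natural where
  open import Data.Fin.Base using (Fin; toℕ)
  open import Data.Fin.Properties using (injective⇒≤; toℕ<n; toℕ-injective)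
  open import Data.List.Base using (List; applyUpTo; concat; filter; length; lookup)
  open import Data.List.Membership.Propositional using (_∈_)
  open import Data.List.Membership.Propositional.Properties
    using (∈-applyUpTo⁺; ∈-applyUpTo⁻; ∈-concat⁺′; ∈-concat⁻′; ∈-filter⁺; ∈-filter⁻)
  open import Data.List.Properties using (length-++; length-applyUpTo; length-filter)
  open import Data.List.Relation.Unary.Any.Properties using (lookup-index)
  import Data.List.Relation.Unary.All.Properties as All
  import Data.List.Relation.Unary.AllPairs.Properties as AllPairs
  import Data.List.Relation.Unary.Unique.Propositional.Properties as Unique
  open import Data.Nat.Base using (_+_; _*_; >-nonZero⁻¹; ≢-nonZero)
  open import Data.Nat.Coprimality using (coprime-Bézout; coprime-divisor)
  open import Data.Nat.Divisibility
    using (_∣_; divides; m%n≡0⇒n∣m; n∣m*n; ∣1⇒≡1; ∣m+n∣m⇒∣n; >⇒∤)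
  open import Data.Nat.DivMod
  open import Data.Nat.GCD using (module Bézout)
  open import Data.Nat.ListAction using (sum)
  open import Data.Nat.Properties
  open import Data.Nat.Tactic.RingSolver using (solve-∀)
  open import Data.Sum.Base using (inj₁; inj₂)
  open import Data.Vec.Properties using (∷-injective)
  open import Function.Base using (_∘_)
  open import Function.Bundles using (mk⇔; Equivalence)
  open import Function.Definitions using (Injective)
  open import Relation.Nullary using (contradiction; yes; no)

  -- Counting in lists, and finite sums.

  -- Pigeonhole on positions: the index of `f i` in `xs` determines `i`. It bounds from below every
  -- list that enumerates the solutions, whatever its order.
  injective⇒≤length : ∀ {a} {X : Set a} {n} {xs : List X} (f : Fin n → X) →
    Injective _≡_ _≡_ f → (∀ i → f i ∈ xs) → n ≤ length xs
  injective⇒≤length {xs = xs} f inj f∈xs = injective⇒≤ λ {i} {j} eq → inj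
    (trans (lookup-index (f∈xs i))
      (trans (cong (lookup xs) eq) (sym (lookup-index (f∈xs j)))))

  ∑ : ℕ → (ℕ → ℕ) → ℕ
  ∑ n f = sum (applyUpTo f n)

  ∑-cong : ∀ n {f g} → (∀ i → i < n → f i ≡ g i) → ∑ n f ≡ ∑ n g
  ∑-cong zero    f≗g = refl
  ∑-cong (suc n) f≗g = cong₂ _+_ (f≗g 0 z<s) (∑-cong n λ i i<n → f≗g (suc i) (s<s i<n))

  ∑-distrib-+ : ∀ n f g → ∑ n (λ i → f i + g i) ≡ ∑ n f + ∑ n g
  ∑-distrib-+ zero    f g = refl
  ∑-distrib-+ (suc n) f g = trans
    (cong (f 0 + g 0 +_) (∑-distrib-+ n (f ∘ suc) (g ∘ suc)))
    (interchange (f 0) (g 0) (∑ n (f ∘ suc)) (∑ n (g ∘ suc)))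
    where
    interchange : ∀ a b c d → a + b + (c + d) ≡ a + c + (b + d)
    interchange = solve-∀

  ∑-const : ∀ n c → ∑ n (λ _ → c) ≡ n * c
  ∑-const zero    c = refl
  ∑-const (suc n) c = cong (c +_) (∑-const n c)

  ∑-distribˡ-* : ∀ n c f → ∑ n (λ i → c * f i) ≡ c * ∑ n f
  ∑-distribˡ-* zero    c f = sym (*-zeroʳ c)
  ∑-distribˡ-* (suc n) c f = trans (cong (c * f 0 +_) (∑-distribˡ-* n c (f ∘ suc)))
    (sym (*-distribˡ-+ c (f 0) _))

  ∑-split : ∀ m n f → ∑ (m + n) f ≡ ∑ m f + ∑ n (λ i → f (m + i))
  ∑-split zero    n f = refl
  ∑-split (suc m) n f = trans (cong (f 0 +_) (∑-split m n (f ∘ suc))) (sym (+-assoc (f 0) _ _))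

  ∑-reverse : ∀ n f → ∑ n (λ i → f (n ∸ suc i)) ≡ ∑ n f
  ∑-reverse zero    f = refl
  ∑-reverse (suc n) f = begin
    f n + ∑ n (λ i → f (n ∸ suc i))  ≡⟨ cong (f n +_) (∑-reverse n f) ⟩
    f n + ∑ n f                      ≡⟨ +-comm (f n) _ ⟩
    ∑ n f + f n                      ≡⟨ cong (∑ n f +_) (sym (trans (+-identityʳ _) (cong f (+-identityʳ n)))) ⟩
    ∑ n f + ∑ 1 (λ i → f (n + i))    ≡⟨ ∑-split n 1 f ⟨
    ∑ (n + 1) f                      ≡⟨ cong (λ m → ∑ m f) (+-comm n 1) ⟩
    ∑ (suc n) f                      ∎
    where open ≡-Reasoning

  length-concat-applyUpTo : ∀ {a} {X : Set a} (f : ℕ → List X) n →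
    length (concat (applyUpTo f n)) ≡ ∑ n (length ∘ f)
  length-concat-applyUpTo f zero    = refl
  length-concat-applyUpTo f (suc n) =
    trans (length-++ (f 0)) (cong (length (f 0) +_) (length-concat-applyUpTo (f ∘ suc) n))

  -- Quotients, and the sum of ⌊j/q⌋.

  m<[1+m/n]*n : ∀ m n .{{_ : NonZero n}} → m < suc (m / n) * n
  m<[1+m/n]*n m n = begin-strict
    m                  ≡⟨ m≡m%n+[m/n]*n m n ⟩
    m % n + m / n * n  <⟨ +-monoˡ-< _ (m%n<n m n) ⟩
    n + m / n * n      ∎
    where open ≤-Reasoning

  m≤n/o⇒o*m≤n : ∀ {m} n o .{{_ : NonZero o}} → m ≤ n / o → o * m ≤ n
  m≤n/o⇒o*m≤n {m} n o m≤n/o = begin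
    o * m        ≡⟨ *-comm o m ⟩
    m * o        ≤⟨ *-monoˡ-≤ o m≤n/o ⟩
    n / o * o    ≤⟨ m/n*n≤m n o ⟩
    n            ∎
    where open ≤-Reasoning

  o*m≤n⇒m≤n/o : ∀ m {n} o .{{_ : NonZero o}} → o * m ≤ n → m ≤ n / o
  o*m≤n⇒m≤n/o m {n} o o*m≤n = begin
    m            ≡⟨ m*n/n≡m m o ⟨
    m * o / o    ≡⟨ cong (_/ o) (*-comm m o) ⟩
    o * m / o    ≤⟨ /-monoˡ-≤ o o*m≤n ⟩
    n / o        ∎
    where open ≤-Reasoning

  [m*n+o]/n≡m+o/n : ∀ m n o .{{_ : NonZero n}} → (m * n + o) / n ≡ m + o / n
  [m*n+o]/n≡m+o/n m n o =
    trans (+-distrib-/-∣ˡ o (n∣m*n m)) (cong (_+ o / n) (m*n/n≡m m n))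

  module _ (q : ℕ) .{{_ : NonZero q}} where

    ∑-/-block : ∀ r ρ → ρ ≤ q → ∑ (r * q + ρ) (_/ q) ≡ ∑ (r * q) (_/ q) + ρ * r
    ∑-/-block r ρ ρ≤q = begin
      ∑ (r * q + ρ) (_/ q)                              ≡⟨ ∑-split (r * q) ρ _ ⟩
      ∑ (r * q) (_/ q) + ∑ ρ (λ i → (r * q + i) / q)    ≡⟨ cong (∑ (r * q) (_/ q) +_) tail ⟩
      ∑ (r * q) (_/ q) + ρ * r                          ∎
      where
      open ≡-Reasoning
      tail : ∑ ρ (λ i → (r * q + i) / q) ≡ ρ * r
      tail = trans
        (∑-cong ρ λ i i<ρ → trans ([m*n+o]/n≡m+o/n r q i)
          (trans (cong (r +_) (m<n⇒m/n≡0 (<-≤-trans i<ρ ρ≤q))) (+-identityʳ r)))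
        (∑-const ρ r)

    ∑-/-multiple : ∀ r → 2 * ∑ (r * q) (_/ q) + r * q ≡ r * r * q
    ∑-/-multiple zero    = refl
    ∑-/-multiple (suc r) = begin
      2 * ∑ (q + r * q) (_/ q) + (q + r * q)          ≡⟨ cong (λ m → 2 * ∑ m (_/ q) + (q + r * q)) (+-comm q _) ⟩
      2 * ∑ (r * q + q) (_/ q) + (q + r * q)          ≡⟨ cong (λ m → 2 * m + (q + r * q)) (∑-/-block r q ≤-refl) ⟩
      2 * (∑ (r * q) (_/ q) + q * r) + (q + r * q)    ≡⟨ regroup (∑ (r * q) (_/ q)) r q ⟩
      (2 * ∑ (r * q) (_/ q) + r * q) + (2 * r * q + q) ≡⟨ cong (_+ (2 * r * q + q)) (∑-/-multiple r) ⟩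
      r * r * q + (2 * r * q + q)                     ≡⟨ square r q ⟩
      suc r * suc r * q                               ∎
      where
      open ≡-Reasoning
      regroup : ∀ w r q → 2 * (w + q * r) + (q + r * q) ≡ (2 * w + r * q) + (2 * r * q + q)
      regroup = solve-∀
      square : ∀ r q → r * r * q + (2 * r * q + q) ≡ suc r * suc r * q
      square = solve-∀

    -- The sum runs over r full blocks of constant quotient and a last block of ρ terms with
    -- quotient r. The case ρ = q, a full last block, is allowed because the remainder used later
    -- ranges over 1, ..., q.
    ∑-/ : ∀ r ρ → ρ ≤ q →
      2 * ∑ (r * q + ρ) (_/ q) + q * (r * suc r) ≡ 2 * r * (r * q + ρ)
    ∑-/ r ρ ρ≤q = begin
      2 * ∑ (r * q + ρ) (_/ q) + q * (r * suc r)           ≡⟨ cong (λ m → 2 * m + q * (r * suc r)) (∑-/-block r ρ ρ≤q) ⟩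
      2 * (∑ (r * q) (_/ q) + ρ * r) + q * (r * suc r)     ≡⟨ regroup (∑ (r * q) (_/ q)) r q ρ ⟩
      (2 * ∑ (r * q) (_/ q) + r * q) + (2 * ρ * r + r * r * q) ≡⟨ cong (_+ (2 * ρ * r + r * r * q)) (∑-/-multiple r) ⟩
      r * r * q + (2 * ρ * r + r * r * q)                  ≡⟨ collect r q ρ ⟩
      2 * r * (r * q + ρ)                                  ∎
      where
      open ≡-Reasoning
      regroup : ∀ w r q ρ → 2 * (w + ρ * r) + q * (r * suc r) ≡ (2 * w + r * q) + (2 * ρ * r + r * r * q)
      regroup = solve-∀
      collect : ∀ r q ρ → r * r * q + (2 * ρ * r + r * r * q) ≡ 2 * r * (r * q + ρ)
      collect = solve-∀

  -- Multiples of B modulo a coprime A, and the sum of their quotients.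

  module _ {A B : ℕ} .{{_ : NonZero A}} (A⊥B : Coprime A B) where

    private
      ≤⇒*-%-injective : ∀ {i j} → i ≤ j → j < A → i * B % A ≡ j * B % A → i ≡ j
      ≤⇒*-%-injective {i} i≤j j<A eq with m≤n⇒∃[o]m+o≡n i≤j
      ... | zero  , refl = sym (+-identityʳ i)
      ... | suc d , refl = contradiction
        (coprime-divisor A⊥B (subst (A ∣_) (*-comm (suc d) B) A∣dB))
        (>⇒∤ (≤-<-trans (m≤n+m (suc d) i) j<A))
        where
        open ≡-Reasoning
        A∣dB : A ∣ suc d * B
        A∣dB = ∣m+n∣m⇒∣n (divides ((i + suc d) * B / A) (+-cancelˡ-≡ (i * B % A) _ _ (begin
          i * B % A + (i * B / A * A + suc d * B)        ≡⟨ +-assoc (i * B % A) _ _ ⟨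
          i * B % A + i * B / A * A + suc d * B          ≡⟨ cong (_+ suc d * B) (m≡m%n+[m/n]*n (i * B) A) ⟨
          i * B + suc d * B                              ≡⟨ *-distribʳ-+ B i (suc d) ⟨
          (i + suc d) * B                                ≡⟨ m≡m%n+[m/n]*n _ A ⟩
          (i + suc d) * B % A + (i + suc d) * B / A * A  ≡⟨ cong (_+ (i + suc d) * B / A * A) eq ⟨
          i * B % A + (i + suc d) * B / A * A            ∎)))
          (n∣m*n (i * B / A))

    *-%-injective : ∀ {i j} → i < A → j < A → i * B % A ≡ j * B % A → i ≡ j
    *-%-injective {i} {j} i<A j<A eq with ≤-total i j
    ... | inj₁ i≤j = ≤⇒*-%-injective i≤j j<A eq
    ... | inj₂ j≤i = sym (≤⇒*-%-injective j≤i i<A (sym eq))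

    *-%-inverse : ∃[ b ] b * B % A ≡ 1 % A
    *-%-inverse with coprime-Bézout A⊥B
    ... | Bézout.-+ x y eq = y , trans (sym (%-congˡ eq)) ([m+kn]%n≡m%n 1 x A)
    -- Here yB ≡ -1, so the inverse of B is -y. Since (yB)² ≡ 1, the natural number `y * B * y`
    -- serves in its place.
    ... | Bézout.+- x y eq = y * B * y , (begin
      y * B * y * B % A                          ≡⟨ [m+kn]%n≡m%n _ (2 * x) A ⟨
      (y * B * y * B + 2 * x * A) % A            ≡⟨ %-congˡ square ⟩
      (1 + x * A * x * A) % A                    ≡⟨ [m+kn]%n≡m%n 1 (x * A * x) A ⟩
      1 % A                                      ∎)
      where
      open ≡-Reasoning
      expand : ∀ y B → y * B * y * B + 2 * (1 + y * B) ≡ 1 + (1 + y * B) * (1 + y * B)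
      expand = solve-∀
      square : y * B * y * B + 2 * x * A ≡ 1 + x * A * x * A
      square = begin
        y * B * y * B + 2 * x * A              ≡⟨ cong (y * B * y * B +_) (*-assoc 2 x A) ⟩
        y * B * y * B + 2 * (x * A)            ≡⟨ cong (λ m → y * B * y * B + 2 * m) eq ⟨
        y * B * y * B + 2 * (1 + y * B)        ≡⟨ expand y B ⟩
        1 + (1 + y * B) * (1 + y * B)          ≡⟨ cong₂ (λ m n → 1 + m * n) eq eq ⟩
        1 + x * A * (x * A)                    ≡⟨ cong (1 +_) (*-assoc (x * A) x A) ⟨
        1 + x * A * x * A                      ∎

    *-%-surjective : ∀ n → ∃[ j ] j < A × j * B % A ≡ n % A
    *-%-surjective n with b , bB%A≡1 ← *-%-inverse = n * b % A , m%n<n (n * b) A , (begin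
      n * b % A * B % A                  ≡⟨ %-distribˡ-* (n * b % A) B A ⟩
      (n * b % A % A) * (B % A) % A      ≡⟨ cong (λ m → m * (B % A) % A) (m%n%n≡m%n (n * b) A) ⟩
      (n * b % A) * (B % A) % A          ≡⟨ %-distribˡ-* (n * b) B A ⟨
      n * b * B % A                      ≡⟨ %-congˡ (*-assoc n b B) ⟩
      n * (b * B) % A                    ≡⟨ %-distribˡ-* n (b * B) A ⟩
      (n % A) * (b * B % A) % A          ≡⟨ cong (λ m → (n % A) * m % A) bB%A≡1 ⟩
      (n % A) * (1 % A) % A              ≡⟨ %-distribˡ-* n 1 A ⟨
      n * 1 % A                          ≡⟨ %-congˡ (*-identityʳ n) ⟩
      n % A                              ∎)
      where open ≡-Reasoning

  -- Reflection j ↦ A − j: for 0 < j < A neither jB nor (A − j)B is divisible by A,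
  -- so their quotients by A add up to B − 1.
  /-reflect : ∀ {A B u v} .{{_ : NonZero A}} .{{_ : NonZero u}} → Coprime A B →
    u < A → u + v ≡ A → suc (u * B / A + v * B / A) ≡ B
  /-reflect {A} {B} {u} {v} A⊥B u<A u+v≡A = ≤-antisym
    (*-cancelʳ-< A _ B (begin-strict
      (u * B / A + v * B / A) * A                              <⟨ m<n+m _ (>-nonZero⁻¹ (u * B % A) {{≢-nonZero uB%A≢0}}) ⟩
      u * B % A + (u * B / A + v * B / A) * A                  ≤⟨ +-monoʳ-≤ (u * B % A) (m≤n+m _ (v * B % A)) ⟩
      u * B % A + (v * B % A + (u * B / A + v * B / A) * A)    ≡⟨ +-assoc (u * B % A) _ _ ⟨
      u * B % A + v * B % A + (u * B / A + v * B / A) * A      ≡⟨ total ⟨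
      B * A                                                    ∎))
    (s≤s⁻¹ (*-cancelʳ-< A B _ (begin-strict
      B * A                                                    ≡⟨ total ⟩
      u * B % A + v * B % A + (u * B / A + v * B / A) * A      <⟨ +-monoˡ-< _ (+-mono-< (m%n<n (u * B) A) (m%n<n (v * B) A)) ⟩
      A + A + (u * B / A + v * B / A) * A                      ≡⟨ +-assoc A A _ ⟩
      suc (suc (u * B / A + v * B / A)) * A                    ∎)))
    where
    open ≤-Reasoning
    uB%A≢0 : u * B % A ≢ 0
    uB%A≢0 eq = >⇒∤ u<A (coprime-divisor A⊥B
      (subst (A ∣_) (*-comm u B) (m%n≡0⇒n∣m (u * B) A eq)))
    regroup : ∀ a b c d A → a + c * A + (b + d * A) ≡ a + b + (c + d) * A
    regroup = solve-∀
    total : B * A ≡ u * B % A + v * B % A + (u * B / A + v * B / A) * A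
    total = begin-equality
      B * A                ≡⟨ cong (B *_) u+v≡A ⟨
      B * (u + v)          ≡⟨ *-comm B (u + v) ⟩
      (u + v) * B          ≡⟨ *-distribʳ-+ B u v ⟩
      u * B + v * B        ≡⟨ cong₂ _+_ (m≡m%n+[m/n]*n (u * B) A) (m≡m%n+[m/n]*n (v * B) A) ⟩
      u * B % A + u * B / A * A + (v * B % A + v * B / A * A)
                           ≡⟨ regroup (u * B % A) (v * B % A) (u * B / A) (v * B / A) A ⟩
      u * B % A + v * B % A + (u * B / A + v * B / A) * A      ∎

  ∑-*/ : ∀ A B .{{_ : NonZero A}} .{{_ : NonZero B}} → Coprime A B →
    2 * ∑ A (λ j → j * B / A) + A + B ≡ A * B + 1
  ∑-*/ A@(suc a) B@(suc b) A⊥B = begin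
    2 * S + A + B         ≡⟨ cong (λ m → m + A + B) doubled ⟩
    a * b + A + B         ≡⟨ expand a b ⟩
    A * B + 1             ∎
    where
    open ≡-Reasoning
    -- The term for j = 0 reduces to zero, which leaves exactly the range 0 < j < A on which the
    -- reflection acts.
    f : ℕ → ℕ
    f i = suc i * B / A
    S = ∑ a f
    expand : ∀ a b → a * b + suc a + suc b ≡ suc a * suc b + 1
    expand = solve-∀
    pair : ∀ i → i < a → f i + f (a ∸ suc i) ≡ b
    pair i i<a = suc-injective (/-reflect A⊥B (s<s i<a)
      (cong suc (trans (+-suc i _) (m+[n∸m]≡n i<a))))
    doubled : 2 * S ≡ a * b
    doubled = begin
      2 * S                                        ≡⟨ cong (S +_) (+-identityʳ S) ⟩
      S + S                                        ≡⟨ cong (S +_) (∑-reverse a f) ⟨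
      S + ∑ a (λ i → f (a ∸ suc i))                ≡⟨ ∑-distrib-+ a f _ ⟨
      ∑ a (λ i → f i + f (a ∸ suc i))              ≡⟨ ∑-cong a pair ⟩
      ∑ a (λ _ → b)                                ≡⟨ ∑-const a b ⟩
      a * b                                        ∎

  -- Generators A, B, C with C + sA = qB: the solutions within one residue class.

  module ThreeGenerators
    (A B C q s p : ℕ) .{{_ : NonZero A}} .{{_ : NonZero q}}
    (A⊥B : Coprime A B) (C+sA≡qB : C + s * A ≡ q * B)
    (sA≤C : s * A ≤ C) (pq≤A : p * q ≤ A)
    where

    private
      as : Vec ℕ 3
      as = A ∷ B ∷ C ∷ []

    -- As 2sA ≤ C + sA = qB, the hypothesis gives sw ≤ (t + 2)B/2, and t + 2 ≤ 2(t + 1). This is the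
    -- only use of sA ≤ C. It bounds how far z can lower a threshold.
    scale-≤ : ∀ t w → q * w ≤ suc (suc t) * A → s * w ≤ suc t * B
    scale-≤ t w qw≤ = *-cancelˡ-≤ q (begin
      q * (s * w)                      ≡⟨ exchange q s w ⟩
      s * (q * w)                      ≤⟨ *-monoʳ-≤ s qw≤ ⟩
      s * (suc (suc t) * A)            ≡⟨ expand s t A ⟩
      s * A + suc t * (s * A)          ≤⟨ +-monoˡ-≤ _ (m≤n*m (s * A) (suc t)) ⟩
      suc t * (s * A) + suc t * (s * A) ≤⟨ +-monoˡ-≤ _ (*-monoʳ-≤ (suc t) sA≤C) ⟩
      suc t * C + suc t * (s * A)      ≡⟨ *-distribˡ-+ (suc t) C _ ⟨
      suc t * (C + s * A)              ≡⟨ cong (suc t *_) C+sA≡qB ⟩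
      suc t * (q * B)                  ≡⟨ exchange (suc t) q B ⟩
      q * (suc t * B)                  ∎)
      where
      open ≤-Reasoning
      exchange : ∀ a b c → a * (b * c) ≡ b * (a * c)
      exchange = solve-∀
      expand : ∀ s t A → s * (suc (suc t) * A) ≡ s * A + suc t * (s * A)
      expand = solve-∀

    module Class (j : ℕ) where

      ρ β e f : ℕ
      ρ = j * B % A
      β = j * B / A
      e = j / q
      f = (j + A) / q

      -- This is jB + mA for m = l − β, so m ≥ tB − sz reads l + sz ≥ β + tB.
      class-value : ℕ → ℕ
      class-value l = ρ + l * A

      ·-expand : ∀ x y z → as · (x ∷ y ∷ z ∷ []) + s * z * A ≡ A * x + B * (y + q * z)
      ·-expand x y z = begin
        A * x + (B * y + (C * z + 0)) + s * z * A    ≡⟨ gather A B C s x y z ⟩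
        A * x + B * y + (C + s * A) * z              ≡⟨ cong (λ m → A * x + B * y + m * z) C+sA≡qB ⟩
        A * x + B * y + q * B * z                    ≡⟨ collect A B q x y z ⟩
        A * x + B * (y + q * z)                      ∎
        where
        open ≡-Reasoning
        gather : ∀ A B C s x y z →
          A * x + (B * y + (C * z + 0)) + s * z * A ≡ A * x + B * y + (C + s * A) * z
        gather = solve-∀
        collect : ∀ A B q x y z → A * x + B * y + q * B * z ≡ A * x + B * (y + q * z)
        collect = solve-∀

      A*x+B*[j+t*A] : ∀ x t → A * x + B * (j + t * A) ≡ ρ + (β + t * B + x) * A
      A*x+B*[j+t*A] x t = begin
        A * x + B * (j + t * A)              ≡⟨ expand A B j t x ⟩
        j * B + (t * B + x) * A              ≡⟨ cong (_+ (t * B + x) * A) (m≡m%n+[m/n]*n (j * B) A) ⟩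
        ρ + β * A + (t * B + x) * A          ≡⟨ collect A B ρ β t x ⟩
        ρ + (β + t * B + x) * A              ∎
        where
        open ≡-Reasoning
        expand : ∀ A B j t x → A * x + B * (j + t * A) ≡ j * B + (t * B + x) * A
        expand = solve-∀
        collect : ∀ A B ρ β t x → ρ + β * A + (t * B + x) * A ≡ ρ + (β + t * B + x) * A
        collect = solve-∀

      shift : ∀ l z → ρ + (l + s * z) * A ≡ class-value l + s * z * A
      shift l z = trans (cong (ρ +_) (*-distribʳ-+ A l (s * z))) (sym (+-assoc ρ _ _))

      solution⁺ : ∀ {l x y z t} → y + q * z ≡ j + t * A → l + s * z ≡ β + t * B + x →
        as · (x ∷ y ∷ z ∷ []) ≡ class-value l
      solution⁺ {l} {x} {y} {z} {t} eq₁ eq₂ = +-cancelʳ-≡ (s * z * A) _ _ (begin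
        as · (x ∷ y ∷ z ∷ []) + s * z * A    ≡⟨ ·-expand x y z ⟩
        A * x + B * (y + q * z)              ≡⟨ cong (λ m → A * x + B * m) eq₁ ⟩
        A * x + B * (j + t * A)              ≡⟨ A*x+B*[j+t*A] x t ⟩
        ρ + (β + t * B + x) * A              ≡⟨ cong (λ m → ρ + m * A) eq₂ ⟨
        ρ + (l + s * z) * A                  ≡⟨ shift l z ⟩
        class-value l + s * z * A            ∎)
        where open ≡-Reasoning

      solution⁻ : ∀ {l x y z} → j < A → as · (x ∷ y ∷ z ∷ []) ≡ class-value l →
        ∃[ t ] y + q * z ≡ j + t * A × l + s * z ≡ β + t * B + x
      solution⁻ {l} {x} {y} {z} j<A sol = t , m≡ , *-cancelʳ-≡ _ _ A (+-cancelˡ-≡ ρ _ _ (begin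
        ρ + (l + s * z) * A         ≡⟨ value ⟨
        A * x + B * m               ≡⟨ cong (λ n → A * x + B * n) m≡ ⟩
        A * x + B * (j + t * A)     ≡⟨ A*x+B*[j+t*A] x t ⟩
        ρ + (β + t * B + x) * A     ∎))
        where
        open ≡-Reasoning
        m = y + q * z
        t = m / A
        value : A * x + B * m ≡ ρ + (l + s * z) * A
        value = begin
          A * x + B * m                        ≡⟨ ·-expand x y z ⟨
          as · (x ∷ y ∷ z ∷ []) + s * z * A    ≡⟨ cong (_+ s * z * A) sol ⟩
          class-value l + s * z * A            ≡⟨ shift l z ⟨
          ρ + (l + s * z) * A                  ∎
        expand : ∀ A B m x → A * x + B * m ≡ m * B + x * A
        expand = solve-∀
        -- Modulo A the equation reads mB ≡ jB, and B is invertible.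
        m%A≡j : m % A ≡ j
        m%A≡j = *-%-injective A⊥B (m%n<n m A) j<A (begin
          m % A * B % A                  ≡⟨ %-distribˡ-* (m % A) B A ⟩
          (m % A % A) * (B % A) % A      ≡⟨ cong (λ n → n * (B % A) % A) (m%n%n≡m%n m A) ⟩
          (m % A) * (B % A) % A          ≡⟨ %-distribˡ-* m B A ⟨
          m * B % A                      ≡⟨ [m+kn]%n≡m%n (m * B) x A ⟨
          (m * B + x * A) % A            ≡⟨ %-congˡ (expand A B m x) ⟨
          (A * x + B * m) % A            ≡⟨ %-congˡ value ⟩
          (ρ + (l + s * z) * A) % A      ≡⟨ [m+kn]%n≡m%n ρ (l + s * z) A ⟩
          ρ % A                          ≡⟨ m%n%n≡m%n (j * B) A ⟩
          ρ                              ∎)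
        m≡ : m ≡ j + t * A
        m≡ = trans (m≡m%n+[m/n]*n m A) (cong (_+ t * A) m%A≡j)

      -- The order of the thresholds up to position p.

      -- Rank v t z: in the list of all pairs with t ≤ 1 and q z ≤ j + t A, ordered by
      -- increasing threshold t B − s z, the pair (t , z) comes at position v.
      data Rank : ℕ → ℕ → ℕ → Set where
        low  : ∀ {v z} → v + z ≡ e → Rank v 0 z
        high : ∀ {v z} → v + z ≡ suc (e + f) → z ≤ f → Rank v 1 z

      -- The row t = 0 fills the positions 0, ..., e and the row t = 1 the positions e + 1, ..., e +
      -- f + 1. The subtractions are exact up to there, and `p≤f` keeps every position up to p
      -- inside this range.
      T Z : ℕ → ℕ
      T v with v ≤? e
      ... | yes _ = 0
      ... | no  _ = 1
      Z v with v ≤? e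
      ... | yes _ = e ∸ v
      ... | no  _ = suc (e + f) ∸ v

      p≤f : p ≤ f
      p≤f = o*m≤n⇒m≤n/o p q
        (≤-trans (≤-reflexive (*-comm q p)) (≤-trans pq≤A (m≤n+m A j)))

      rank : ∀ {v} → v ≤ p → Rank v (T v) (Z v)
      rank {v} v≤p with v ≤? e
      ... | yes v≤e = low (m+[n∸m]≡n v≤e)
      ... | no  v≰e = high (m+[n∸m]≡n (≤-trans v≤p (≤-trans p≤f (m≤n⇒m≤1+n (m≤n+m f e)))))
        (m≤n+o⇒m∸n≤o (suc (e + f)) v (+-monoˡ-≤ f (≰⇒> v≰e)))

      rank⇒T,Z : ∀ {v t z} → Rank v t z → T v ≡ t × Z v ≡ z
      rank⇒T,Z {v} {z = z} (low eq) with v ≤? e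
      ... | yes _   = refl , trans (cong (_∸ v) (sym eq)) (m+n∸m≡n v z)
      ... | no  v≰e = contradiction (subst (v ≤_) eq (m≤m+n v z)) v≰e
      rank⇒T,Z {v} {z = z} (high eq z≤f) with v ≤? e
      ... | yes v≤e = contradiction eq (<⇒≢ (s≤s (+-mono-≤ v≤e z≤f)))
      ... | no  _   = refl , trans (cong (_∸ v) (sym eq)) (m+n∸m≡n v z)

      rank-injective : ∀ {v v′ t z} → Rank v t z → Rank v′ t z → v ≡ v′
      rank-injective {z = z} (low eq)    (low eq′)    = +-cancelʳ-≡ z _ _ (trans eq (sym eq′))
      rank-injective {z = z} (high eq _) (high eq′ _) = +-cancelʳ-≡ z _ _ (trans eq (sym eq′))

      rank⇒valid : ∀ {v t z} → Rank v t z → q * z ≤ j + t * A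
      rank⇒valid {v} {z = z} (low eq) = ≤-trans
        (m≤n/o⇒o*m≤n j q (subst (z ≤_) eq (m≤n+m z v))) (m≤m+n j 0)
      rank⇒valid (high _ z≤f) = ≤-trans (m≤n/o⇒o*m≤n (j + A) q z≤f)
        (≤-reflexive (cong (j +_) (sym (+-identityʳ A))))

      module _ (j<A : j < A) where

        valid⇒q*z≤[1+t]*A : ∀ t {z} → q * z ≤ j + t * A → q * z ≤ suc t * A
        valid⇒q*z≤[1+t]*A t valid = ≤-trans valid (+-monoˡ-≤ (t * A) (<⇒≤ j<A))

        threshold-mono : ∀ {v w t t′ z z′} → Rank v t z → Rank w t′ z′ → v ≤ w →
          t * B + s * z′ ≤ t′ * B + s * z
        threshold-mono {z = z} {z′} r r′ v≤w with r | r′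
        ... | low eq    | low eq′    = *-monoʳ-≤ s (+-cancelˡ-≤ _ z′ z
          (≤-trans (+-monoˡ-≤ z′ v≤w) (≤-reflexive (trans eq′ (sym eq)))))
        -- A threshold with t = 1 is nonnegative by `scale-≤`, and one with t = 0 is at most zero.
        ... | low _     | high _ _   = ≤-trans (scale-≤ 0 z′ (valid⇒q*z≤[1+t]*A 1 (rank⇒valid r′))) (m≤m+n _ _)
        ... | high eq z≤f | low eq′  = contradiction eq (<⇒≢ (s≤s (+-mono-≤
          (≤-trans v≤w (subst (_ ≤_) eq′ (m≤m+n _ z′))) z≤f)))
        ... | high eq _ | high eq′ _ = +-monoʳ-≤ (1 * B) (*-monoʳ-≤ s (+-cancelˡ-≤ _ z′ z
          (≤-trans (+-monoˡ-≤ z′ v≤w) (≤-reflexive (trans eq′ (sym eq))))))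

        -- Within one row a smaller threshold means a larger z, hence an earlier position. Across
        -- rows, a pair with t′ = 0 precedes all of t = 1, and the remaining cases with t′ > t
        -- contradict the strict inequality.
        rank-below : ∀ {t t′ z z′} → Rank p t z → q * z′ ≤ j + t′ * A →
          t′ * B + s * z < t * B + s * z′ → ∃[ v ] v < p × Rank v t′ z′
        rank-below {t′ = zero} {z} {z′} (low eq) valid below =
          e ∸ z′ , +-cancelʳ-< z′ _ _ (begin-strict
            e ∸ z′ + z′   ≡⟨ m∸n+n≡m z′≤e ⟩
            e             ≡⟨ eq ⟨
            p + z         <⟨ +-monoʳ-< p (*-cancelˡ-< s z z′ below) ⟩
            p + z′        ∎) , low (m∸n+n≡m z′≤e)
          where
          open ≤-Reasoning
          z′≤e : z′ ≤ e
          z′≤e = o*m≤n⇒m≤n/o z′ q (subst (q * z′ ≤_) (+-identityʳ j) valid)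
        rank-below {t′ = suc t} {z} {z′} (low _) valid below = contradiction
          (≤-trans (scale-≤ t z′ (valid⇒q*z≤[1+t]*A (suc t) valid)) (m≤m+n _ (s * z)))
          (<⇒≱ below)
        rank-below {t′ = zero} {z} {z′} (high eq z≤f) valid below =
          e ∸ z′ , ≤-<-trans (m∸n≤m e z′) e<p , low (m∸n+n≡m z′≤e)
          where
          z′≤e : z′ ≤ e
          z′≤e = o*m≤n⇒m≤n/o z′ q (subst (q * z′ ≤_) (+-identityʳ j) valid)
          e<p : e < p
          e<p = +-cancelʳ-≤ f (suc e) p (subst (_≤ p + f) eq (+-monoʳ-≤ p z≤f))
        rank-below {t′ = suc zero} {z} {z′} (high eq z≤f) valid below =
          suc (e + f) ∸ z′ , +-cancelʳ-< z′ _ _ (begin-strict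
            suc (e + f) ∸ z′ + z′   ≡⟨ m∸n+n≡m z′≤1+e+f ⟩
            suc (e + f)             ≡⟨ eq ⟨
            p + z                   <⟨ +-monoʳ-< p (*-cancelˡ-< s z z′ (+-cancelˡ-< (1 * B) _ _ below)) ⟩
            p + z′                  ∎) , high (m∸n+n≡m z′≤1+e+f) z′≤f
          where
          open ≤-Reasoning
          z′≤f : z′ ≤ f
          z′≤f = o*m≤n⇒m≤n/o z′ q (subst (λ a → q * z′ ≤ j + a) (*-identityˡ A) valid)
          z′≤1+e+f : z′ ≤ suc (e + f)
          z′≤1+e+f = ≤-trans z′≤f (m≤n⇒m≤1+n (m≤n+m f e))
        rank-below {t′ = suc (suc t)} {z} {z′} (high eq z≤f) valid below = contradiction
          (begin
            1 * B + s * z′                        ≤⟨ +-monoʳ-≤ (1 * B) (*-monoʳ-≤ s (m≤n+m∸n z′ z)) ⟩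
            1 * B + s * (z + (z′ ∸ z))            ≡⟨ regroup B s z (z′ ∸ z) ⟩
            B + s * (z′ ∸ z) + s * z              ≤⟨ +-monoˡ-≤ (s * z) (+-monoʳ-≤ B (scale-≤ t (z′ ∸ z) gap)) ⟩
            suc (suc t) * B + s * z               ∎)
          (<⇒≱ below)
          where
          open ≤-Reasoning
          regroup : ∀ B s z d → 1 * B + s * (z + d) ≡ B + s * d + s * z
          regroup = solve-∀
          -- From p + z = e + f + 1 follows (p + z)q ≥ (f + 1)q > j + A, and pq takes away at most
          -- A. Hence z′ - z obeys the bound of `gap`, in which j has cancelled, and `scale-≤`
          -- applies to the difference.
          j≤qz : j ≤ q * z
          j≤qz = <⇒≤ (+-cancelˡ-< A _ _ (begin-strict
            A + j              ≡⟨ +-comm A j ⟩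
            j + A              <⟨ m<[1+m/n]*n (j + A) q ⟩
            suc f * q          ≤⟨ *-monoˡ-≤ q (s≤s (m≤n+m f e)) ⟩
            suc (e + f) * q    ≡⟨ cong (_* q) eq ⟨
            (p + z) * q        ≡⟨ *-distribʳ-+ q p z ⟩
            p * q + z * q      ≤⟨ +-mono-≤ pq≤A (≤-reflexive (*-comm z q)) ⟩
            A + q * z          ∎))
          gap : q * (z′ ∸ z) ≤ suc (suc t) * A
          gap = begin
            q * (z′ ∸ z)       ≡⟨ *-distribˡ-∸ q z′ z ⟩
            q * z′ ∸ q * z     ≤⟨ m≤n+o⇒m∸n≤o (q * z′) (q * z) (≤-trans valid (+-monoˡ-≤ _ j≤qz)) ⟩
            suc (suc t) * A    ∎

      -- Solutions attached to pairs, and how many there are.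

      candidate : ℕ → ℕ → ℕ → Vec ℕ 3
      candidate l t z = (l + s * z ∸ (β + t * B)) ∷ (j + t * A ∸ q * z) ∷ z ∷ []

      candidate-solution : ∀ t {l z} → q * z ≤ j + t * A → β + t * B ≤ l + s * z →
        as · candidate l t z ≡ class-value l
      candidate-solution t valid reached =
        solution⁺ {t = t} (m∸n+n≡m valid) (sym (m+[n∸m]≡n reached))

      candidate-complete : ∀ t {l x y z} → y + q * z ≡ j + t * A → l + s * z ≡ β + t * B + x →
        x ∷ y ∷ z ∷ [] ≡ candidate l t z
      candidate-complete t {x = x} {y} {z} eq₁ eq₂ = cong₂ (λ x y → x ∷ y ∷ z ∷ [])
        (trans (sym (m+n∸m≡n (β + t * B) x)) (cong (_∸ (β + t * B)) (sym eq₂)))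
        (trans (sym (m+n∸n≡m y (q * z))) (cong (_∸ q * z) eq₁))

      -- The first coordinate is ignored, since it is truncated to 0 when the threshold is not
      -- reached. The third is z, and the second then determines t because qz ≤ j + tA makes its
      -- subtraction exact.
      candidate-injective : ∀ {l v v′ t t′ z z′} → Rank v t z → Rank v′ t′ z′ →
        candidate l t z ≡ candidate l t′ z′ → v ≡ v′
      candidate-injective {v′ = v′} {t} {t′} {z} r r′ eq
        with y∷z≡y′∷z′ ← proj₂ (∷-injective eq)
        with refl ← proj₁ (∷-injective (proj₂ (∷-injective y∷z≡y′∷z′))) =
        rank-injective r (subst (λ t → Rank v′ t z) (sym t≡t′) r′)
        where
        t≡t′ : t ≡ t′
        t≡t′ = *-cancelʳ-≡ t t′ A (+-cancelˡ-≡ j _ _ (∸-cancelʳ-≡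
          (rank⇒valid r) (rank⇒valid r′) (proj₁ (∷-injective y∷z≡y′∷z′))))

      nth : ℕ → ℕ → Vec ℕ 3
      nth l v = candidate l (T v) (Z v)

      -- The threshold at position p, shifted by β so that it bounds l instead of m. It is the
      -- number of l for which `class-value l` has at most p solutions.
      count : ℕ
      count = β + T p * B ∸ s * Z p

      -- The subtraction in `count` is exact: sA ≤ qB and qZ ≤ j + TA give sZA ≤ B(j + TA), and the
      -- quotient of the right side by A is β + TB.
      s*Z≤β+T*B : s * Z p ≤ β + T p * B
      s*Z≤β+T*B = s≤s⁻¹ (*-cancelʳ-< A _ _ (begin-strict
        s * Z p * A                    ≤⟨ *-cancelˡ-≤ q scaled ⟩
        B * (j + T p * A)              ≡⟨ cong (_+ B * (j + T p * A)) (*-zeroʳ A) ⟨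
        A * 0 + B * (j + T p * A)      ≡⟨ A*x+B*[j+t*A] 0 (T p) ⟩
        ρ + (β + T p * B + 0) * A      <⟨ +-monoˡ-< _ (m%n<n (j * B) A) ⟩
        A + (β + T p * B + 0) * A      ≡⟨ cong (λ m → A + m * A) (+-identityʳ (β + T p * B)) ⟩
        suc (β + T p * B) * A          ∎))
        where
        open ≤-Reasoning
        regroup : ∀ q s A z → q * (s * z * A) ≡ s * A * (q * z)
        regroup = solve-∀
        scaled : q * (s * Z p * A) ≤ q * (B * (j + T p * A))
        scaled = begin
          q * (s * Z p * A)             ≡⟨ regroup q s A (Z p) ⟩
          s * A * (q * Z p)             ≤⟨ *-mono-≤ (m≤n+m (s * A) C) (rank⇒valid (rank ≤-refl)) ⟩
          (C + s * A) * (j + T p * A)   ≡⟨ cong (_* (j + T p * A)) C+sA≡qB ⟩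
          q * B * (j + T p * A)         ≡⟨ *-assoc q B _ ⟩
          q * (B * (j + T p * A))       ∎

      count+s*Z : count + s * Z p ≡ β + T p * B
      count+s*Z = m∸n+n≡m s*Z≤β+T*B

      module _ (j<A : j < A) where

        few-solutions : ∀ {l} → l < count →
          ∃[ c ] Denumerant (class-value l) as c × c ≤ p
        few-solutions {l} l<g = length solutions ,
          (solutions , unique , (λ xs → mk⇔ (proj₂ ∘ ∈-filter⁻ solves? {xs = candidates}) (complete xs)) , refl) ,
          ≤-trans (length-filter solves? candidates) (≤-reflexive (length-applyUpTo (nth l) p))
          where
          solves? = λ xs → as · xs ≟ class-value l
          candidates = applyUpTo (nth l) p
          -- A pair before position p may still have its threshold above the given level, so not
          -- every candidate is a solution. Filtering keeps exactly those that are.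
          solutions = filter solves? candidates
          unique = Unique.filter⁺ solves? (Unique.applyUpTo⁺₁ (nth l) p λ v<w w<p eq →
            <⇒≢ v<w (candidate-injective {l} (rank (<⇒≤ (<-trans v<w w<p))) (rank (<⇒≤ w<p)) eq))
          below : ∀ t {x z} → l + s * z ≡ β + t * B + x → t * B + s * Z p < T p * B + s * z
          below t {x} {z} eq = +-cancelˡ-< (β + l) _ _ (begin-strict
            β + l + (t * B + s * Z p)        ≡⟨ interchange β l (t * B) (s * Z p) ⟩
            β + t * B + (l + s * Z p)        <⟨ +-monoʳ-< (β + t * B) (+-monoˡ-< (s * Z p) l<g) ⟩
            β + t * B + (count + s * Z p) ≡⟨ cong (β + t * B +_) count+s*Z ⟩
            β + t * B + (β + T p * B)        ≤⟨ +-monoˡ-≤ _ (subst (β + t * B ≤_) (sym eq) (m≤m+n _ x)) ⟩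
            l + s * z + (β + T p * B)        ≡⟨ regroup l (s * z) β (T p * B) ⟩
            β + l + (T p * B + s * z)        ∎)
            where
            open ≤-Reasoning
            interchange : ∀ a b c d → a + b + (c + d) ≡ a + c + (b + d)
            interchange = solve-∀
            regroup : ∀ a b c d → a + b + (c + d) ≡ c + a + (d + b)
            regroup = solve-∀
          complete : ∀ xs → as · xs ≡ class-value l → xs ∈ solutions
          complete (x ∷ y ∷ z ∷ []) sol with solution⁻ j<A sol
          ... | t , eq₁ , eq₂
            with rank-below j<A {t′ = t} (rank ≤-refl) (subst (q * z ≤_) eq₁ (m≤n+m _ y)) (below t eq₂)
          ... | v , v<p , r = ∈-filter⁺ solves? (subst (_∈ candidates) nth≡ (∈-applyUpTo⁺ (nth l) v<p)) sol
            where
            nth≡ : nth l v ≡ x ∷ y ∷ z ∷ []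
            nth≡ = trans (cong₂ (candidate l) (proj₁ (rank⇒T,Z r)) (proj₂ (rank⇒T,Z r)))
              (sym (candidate-complete t eq₁ eq₂))

        many-solutions : ∀ {l c} → count ≤ l → Denumerant (class-value l) as c → p < c
        many-solutions {l} g≤l (xs , _ , ∈⇔ , refl) = injective⇒≤length {n = suc p} (nth l ∘ toℕ)
          (λ {v} {w} eq → toℕ-injective (candidate-injective {l} (rank (v≤p v)) (rank (v≤p w)) eq))
          (λ v → Equivalence.from (∈⇔ _) (candidate-solution (T (toℕ v))
            (rank⇒valid (rank (v≤p v))) (reached (v≤p v))))
          where
          v≤p : (v : Fin (suc p)) → toℕ v ≤ p
          v≤p v = s≤s⁻¹ (toℕ<n v)
          reached : ∀ {v} → v ≤ p → β + T v * B ≤ l + s * Z v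
          reached {v} v≤p = +-cancelʳ-≤ (s * Z p) _ _ (begin
            β + T v * B + s * Z p             ≡⟨ +-assoc β _ _ ⟩
            β + (T v * B + s * Z p)           ≤⟨ +-monoʳ-≤ β (threshold-mono j<A (rank v≤p) (rank ≤-refl) v≤p) ⟩
            β + (T p * B + s * Z v)           ≡⟨ +-assoc β _ _ ⟨
            β + T p * B + s * Z v             ≡⟨ cong (_+ s * Z v) count+s*Z ⟨
            count + s * Z p + s * Z v     ≤⟨ +-monoˡ-≤ _ (+-monoˡ-≤ _ g≤l) ⟩
            l + s * Z p + s * Z v             ≡⟨ swap l (s * Z p) (s * Z v) ⟩
            l + s * Z v + s * Z p             ∎)
            where
            open ≤-Reasoning
            swap : ∀ a b c → a + b + c ≡ a + c + b
            swap = solve-∀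

    -- The Sylvester number as a sum over residue classes.

    open Class

    exceptional : ℕ → List ℕ
    exceptional j = applyUpTo (λ l → ρ j + l * A) (count j)

    -- As j runs below A, the remainders of jB run once through all residues modulo A. The classes
    -- are therefore disjoint and cover every n, with level l = n / A.
    sylvester : SylvesterNumber p as (∑ A count)
    sylvester = concat (applyUpTo exceptional A) , unique ,
      (λ n → mk⇔ (few n) (listed n)) ,
      trans (length-concat-applyUpTo exceptional A)
        (∑-cong A λ j _ → length-applyUpTo (λ l → ρ j + l * A) (count j))
      where
      unique = Unique.concat⁺
        (All.applyUpTo⁺₂ exceptional A λ j → Unique.applyUpTo⁺₁ _ _ λ l<l′ _ eq →
          <⇒≢ l<l′ (*-cancelʳ-≡ _ _ A (+-cancelˡ-≡ (ρ j) _ _ eq)))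
        (AllPairs.applyUpTo⁺₁ exceptional A λ {i} {j} i<j j<A (n∈i , n∈j) →
          let l , _ , n≡  = ∈-applyUpTo⁻ _ n∈i
              m , _ , n≡′ = ∈-applyUpTo⁻ _ n∈j
          in <⇒≢ i<j (*-%-injective A⊥B (<-trans i<j j<A) j<A
            (trans (sym (residue i l)) (trans (%-congˡ (trans (sym n≡) n≡′)) (residue j m)))))
        where
        residue : ∀ j l → (ρ j + l * A) % A ≡ ρ j
        residue j l = trans ([m+kn]%n≡m%n (ρ j) l A) (m%n%n≡m%n (j * B) A)
      few : ∀ n → n ∈ concat (applyUpTo exceptional A) → ∃[ c ] Denumerant n as c × c ≤ p
      few n n∈ with ∈-concat⁻′ (applyUpTo exceptional A) n∈
      ... | _ , n∈xs , xs∈ with ∈-applyUpTo⁻ exceptional xs∈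
      ... | j , j<A , refl with ∈-applyUpTo⁻ _ n∈xs
      ... | l , l<g , refl = few-solutions j j<A l<g
      listed : ∀ n → ∃[ c ] Denumerant n as c × c ≤ p → n ∈ concat (applyUpTo exceptional A)
      listed n (c , d , c≤p) with *-%-surjective A⊥B n
      ... | j , j<A , ρ≡ with n / A <? count j
      ... | yes l<g = ∈-concat⁺′
        (subst (_∈ exceptional j) (sym n≡) (∈-applyUpTo⁺ (λ l → ρ j + l * A) l<g))
        (∈-applyUpTo⁺ exceptional j<A)
        where
        n≡ : n ≡ ρ j + n / A * A
        n≡ = trans (m≡m%n+[m/n]*n n A) (cong (_+ n / A * A) (sym ρ≡))
      ... | no l≮g = contradiction c≤p (<⇒≱ (many-solutions j j<A (≮⇒≥ l≮g)
        (subst (λ n → Denumerant n as c)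
          (trans (m≡m%n+[m/n]*n n A) (cong (_+ n / A * A) (sym ρ≡))) d)))

    -- Evaluation of the sum of the counts.

    private
      A′ : ℕ
      A′ = A ∸ p * q

      pq+A′≡A : p * q + A′ ≡ A
      pq+A′≡A = m+[n∸m]≡n pq≤A

      -- Position p falls in the row t = 1 exactly when e < p, that is when j < pq. With A = pq + A′
      -- one has f = p + ⌊(A′ + j)/q⌋, so p cancels from z = e + f + 1 - p.
      high-rank : ∀ j → j < p * q → Rank j p 1 (suc (j / q) + (A′ + j) / q)
      high-rank j j<pq = high
        (trans (+-suc p _) (cong suc (trans (swap p (j / q) _) (cong (j / q +_) (sym f≡)))))
        (subst (suc (j / q) + (A′ + j) / q ≤_) (sym f≡) (+-monoˡ-≤ _ (m<n*o⇒m/o<n j<pq)))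
        where
        swap : ∀ a b c → a + (b + c) ≡ b + (a + c)
        swap = solve-∀
        f≡ : f j ≡ p + (A′ + j) / q
        f≡ = trans (cong (_/ q) (begin
          j + A                 ≡⟨ +-comm j A ⟩
          A + j                 ≡⟨ cong (_+ j) pq+A′≡A ⟨
          p * q + A′ + j        ≡⟨ +-assoc (p * q) A′ j ⟩
          p * q + (A′ + j)      ∎)) ([m*n+o]/n≡m+o/n p q (A′ + j))
          where open ≡-Reasoning

      low-rank : ∀ i → Rank (p * q + i) p 0 (i / q)
      low-rank i = low (sym ([m*n+o]/n≡m+o/n p q i))

      ∑-split-A : ∀ g → ∑ A g ≡ ∑ (p * q) g + ∑ A′ (λ i → g (p * q + i))
      ∑-split-A g = trans (cong (λ m → ∑ m g) (sym pq+A′≡A)) (∑-split (p * q) A′ g)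

    ∑-T : ∑ A (λ j → T j p) ≡ p * q
    ∑-T = begin
      ∑ A (λ j → T j p)                                            ≡⟨ ∑-split-A _ ⟩
      ∑ (p * q) (λ j → T j p) + ∑ A′ (λ i → T (p * q + i) p)
        ≡⟨ cong₂ _+_ (∑-cong (p * q) λ j j<pq → proj₁ (rank⇒T,Z j (high-rank j j<pq)))
                     (∑-cong A′ λ i _ → proj₁ (rank⇒T,Z (p * q + i) (low-rank i))) ⟩
      ∑ (p * q) (λ _ → 1) + ∑ A′ (λ _ → 0)                         ≡⟨ cong₂ _+_ (∑-const (p * q) 1) (∑-const A′ 0) ⟩
      p * q * 1 + A′ * 0                                           ≡⟨ simplify (p * q) A′ ⟩
      p * q                                                        ∎
      where
      open ≡-Reasoning
      simplify : ∀ a b → a * 1 + b * 0 ≡ a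
      simplify = solve-∀

    ∑-Z : ∑ A (λ j → Z j p) ≡ p * q + ∑ (p * q) (_/ q) + ∑ A (_/ q)
    ∑-Z = begin
      ∑ A (λ j → Z j p)                                            ≡⟨ ∑-split-A _ ⟩
      ∑ (p * q) (λ j → Z j p) + ∑ A′ (λ i → Z (p * q + i) p)
        ≡⟨ cong₂ _+_ (∑-cong (p * q) λ j j<pq → proj₂ (rank⇒T,Z j (high-rank j j<pq)))
                     (∑-cong A′ λ i _ → proj₂ (rank⇒T,Z (p * q + i) (low-rank i))) ⟩
      ∑ (p * q) (λ j → suc (j / q) + (A′ + j) / q) + ∑ A′ (_/ q)
        ≡⟨ cong (_+ ∑ A′ (_/ q)) (trans (∑-distrib-+ (p * q) (λ j → 1 + j / q) _)
             (cong (_+ tail) (∑-distrib-+ (p * q) (λ _ → 1) (_/ q)))) ⟩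
      ∑ (p * q) (λ _ → 1) + ∑ (p * q) (_/ q) + tail + ∑ A′ (_/ q)
        ≡⟨ cong (λ m → m + ∑ (p * q) (_/ q) + tail + ∑ A′ (_/ q)) (trans (∑-const (p * q) 1) (*-identityʳ (p * q))) ⟩
      p * q + ∑ (p * q) (_/ q) + tail + ∑ A′ (_/ q)                ≡⟨ +-assoc (p * q + ∑ (p * q) (_/ q)) tail _ ⟩
      p * q + ∑ (p * q) (_/ q) + (tail + ∑ A′ (_/ q))              ≡⟨ cong (p * q + ∑ (p * q) (_/ q) +_) rejoin ⟩
      p * q + ∑ (p * q) (_/ q) + ∑ A (_/ q)                        ∎
      where
      open ≡-Reasoning
      tail : ℕ
      tail = ∑ (p * q) (λ j → (A′ + j) / q)
      rejoin : tail + ∑ A′ (_/ q) ≡ ∑ A (_/ q)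
      -- The quotients of 0, ..., A′ - 1 come from the classes j ≥ pq and those of A′, ..., A - 1
      -- from the classes j < pq.
      rejoin = begin
        tail + ∑ A′ (_/ q)      ≡⟨ +-comm tail _ ⟩
        ∑ A′ (_/ q) + tail      ≡⟨ ∑-split A′ (p * q) (_/ q) ⟨
        ∑ (A′ + p * q) (_/ q)   ≡⟨ cong (λ m → ∑ m (_/ q)) (trans (+-comm A′ _) pq+A′≡A) ⟩
        ∑ A (_/ q)              ∎

    ∑-count : ∑ A count + s * ∑ A (λ j → Z j p) ≡ ∑ A (λ j → j * B / A) + B * (p * q)
    ∑-count = begin
      ∑ A count + s * ∑ A (λ j → Z j p)                  ≡⟨ cong (∑ A count +_) (∑-distribˡ-* A s _) ⟨
      ∑ A count + ∑ A (λ j → s * Z j p)                  ≡⟨ ∑-distrib-+ A _ _ ⟨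
      ∑ A (λ j → count j + s * Z j p)                    ≡⟨ ∑-cong A (λ j _ → trans (count+s*Z j) (cong (β j +_) (*-comm (T j p) B))) ⟩
      ∑ A (λ j → β j + B * T j p)                            ≡⟨ ∑-distrib-+ A _ _ ⟩
      ∑ A β + ∑ A (λ j → B * T j p)                          ≡⟨ cong (∑ A β +_) (trans (∑-distribˡ-* A B _) (cong (B *_) ∑-T)) ⟩
      ∑ A (λ j → j * B / A) + B * (p * q)                    ∎
      where open ≡-Reasoning

    -- The factor (r + p + 1)(r - p) of the theorem is r(r + 1) - p(p + 1), kept here on two sides
    -- of an equation in ℕ. Its first term stems from the sum of ⌊j/q⌋ over j < A, its second from
    -- the terms 1 + ⌊j/q⌋ with j < pq.
    sylvester-formula : .{{_ : NonZero B}} → ∀ r u → r * q + u ≡ A → u ≤ q →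
      2 * ∑ A count + s * (q * (p * suc p) + 2 * r * A) + A + B
        ≡ A * B + 1 + 2 * (B * (p * q)) + s * (q * (r * suc r))
    sylvester-formula r u rq+u≡A u≤q = begin
      2 * N + s * (q * (p * suc p) + 2 * r * A) + A + B
        ≡⟨ cong (λ m → 2 * N + s * (q * (p * suc p) + m) + A + B) (∑-/-A) ⟨
      2 * N + s * (q * (p * suc p) + (2 * W + q * (r * suc r))) + A + B
        ≡⟨ cong (λ m → 2 * N + s * (m + (2 * W + q * (r * suc r))) + A + B) ∑-/-pq ⟨
      2 * N + s * (2 * (p * q + V) + (2 * W + q * (r * suc r))) + A + B
        ≡⟨ regroup N s (p * q) V W (q * (r * suc r)) A B ⟩
      2 * (N + s * (p * q + V + W)) + A + B + s * (q * (r * suc r))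
        ≡⟨ cong (λ m → 2 * (N + s * m) + A + B + s * (q * (r * suc r))) ∑-Z ⟨
      2 * (N + s * ∑ A (λ j → Z j p)) + A + B + s * (q * (r * suc r))
        ≡⟨ cong (λ m → 2 * m + A + B + s * (q * (r * suc r))) ∑-count ⟩
      2 * (S + B * (p * q)) + A + B + s * (q * (r * suc r))
        ≡⟨ separate S (B * (p * q)) A B (s * (q * (r * suc r))) ⟩
      2 * S + A + B + 2 * (B * (p * q)) + s * (q * (r * suc r))
        ≡⟨ cong (λ m → m + 2 * (B * (p * q)) + s * (q * (r * suc r))) (∑-*/ A B A⊥B) ⟩
      A * B + 1 + 2 * (B * (p * q)) + s * (q * (r * suc r))    ∎
      where
      open ≡-Reasoning
      N = ∑ A count
      S = ∑ A (λ j → j * B / A)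
      V = ∑ (p * q) (_/ q)
      W = ∑ A (_/ q)
      ∑-/-A : 2 * W + q * (r * suc r) ≡ 2 * r * A
      ∑-/-A = subst (λ a → 2 * ∑ a (_/ q) + q * (r * suc r) ≡ 2 * r * a) rq+u≡A (∑-/ q r u u≤q)
      ∑-/-pq : 2 * (p * q + V) ≡ q * (p * suc p)
      ∑-/-pq = begin
        2 * (p * q + V)          ≡⟨ isolate (p * q) V ⟩
        2 * V + p * q + p * q    ≡⟨ cong (_+ p * q) (∑-/-multiple q p) ⟩
        p * p * q + p * q        ≡⟨ factor p q ⟩
        q * (p * suc p)          ∎
        where
        isolate : ∀ a v → 2 * (a + v) ≡ 2 * v + a + a
        isolate = solve-∀
        factor : ∀ p q → p * p * q + p * q ≡ q * (p * suc p)
        factor = solve-∀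
      regroup : ∀ n s a v w b A B →
        2 * n + s * (2 * (a + v) + (2 * w + b)) + A + B ≡ 2 * (n + s * (a + v + w)) + A + B + s * b
      regroup = solve-∀
      separate : ∀ S b A B c → 2 * (S + b) + A + B + c ≡ 2 * S + A + B + 2 * b + c
      separate = solve-∀

  -- Fibonacci numbers satisfy the hypotheses on A, B, C, q, s.

  fib-coprime-suc : ∀ n → Coprime (fib n) (fib (suc n))
  fib-coprime-suc zero    (_ , d∣1)      = ∣1⇒≡1 d∣1
  fib-coprime-suc (suc n) (d∣a , d∣a+b)  = fib-coprime-suc n (∣m+n∣m⇒∣n d∣a+b d∣a , d∣a)

  fib-coprime-2+ : ∀ n → Coprime (fib n) (fib (2 + n))
  fib-coprime-2+ n {d} (d∣a , d∣b+a) = fib-coprime-suc n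
    (d∣a , ∣m+n∣m⇒∣n (subst (d ∣_) (+-comm (fib (suc n)) (fib n)) d∣b+a) d∣a)

  -- For fixed i both sides obey the Fibonacci recurrence in h, so two base cases suffice. With h =
  -- k - 2 this is C + sA = qB.
  fib-2+h+i : ∀ h i → fib (2 + h + i) + fib h * fib i ≡ fib (2 + h) * fib (2 + i)
  fib-2+h+i zero          i = trans (+-identityʳ _) (sym (*-identityˡ _))
  fib-2+h+i (suc zero)    i = base (fib (suc i)) (fib i)
    where
    base : ∀ a b → a + b + a + 1 * b ≡ 2 * (a + b)
    base = solve-∀
  fib-2+h+i (suc (suc h)) i = begin
    fib (3 + h + i) + fib (2 + h + i) + (fib (suc h) + fib h) * fib i
      ≡⟨ interleave (fib (3 + h + i)) (fib (2 + h + i)) (fib (suc h)) (fib h) (fib i) ⟩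
    (fib (3 + h + i) + fib (suc h) * fib i) + (fib (2 + h + i) + fib h * fib i)
      ≡⟨ cong₂ _+_ (fib-2+h+i (suc h) i) (fib-2+h+i h i) ⟩
    fib (3 + h) * fib (2 + i) + fib (2 + h) * fib (2 + i)
      ≡⟨ *-distribʳ-+ (fib (2 + i)) (fib (3 + h)) (fib (2 + h)) ⟨
    fib (4 + h) * fib (2 + i)  ∎
    where
    open ≡-Reasoning
    interleave : ∀ a b c d e → a + b + (c + d) * e ≡ (a + c * e) + (b + d * e)
    interleave = solve-∀

  fib-*-≤ : ∀ h i → fib h * fib i ≤ fib (2 + h + i)
  fib-*-≤ zero          i = z≤n
  fib-*-≤ (suc zero)    i = begin
    fib i + 0                                ≡⟨ +-identityʳ _ ⟩
    fib i                                    ≤⟨ m≤n+m (fib i) (fib (suc i)) ⟩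
    fib (2 + i)                              ≤⟨ m≤m+n (fib (2 + i)) (fib (suc i)) ⟩
    fib (3 + i)                              ∎
    where open ≤-Reasoning
  fib-*-≤ (suc (suc h)) i = begin
    (fib (suc h) + fib h) * fib i            ≡⟨ *-distribʳ-+ (fib i) (fib (suc h)) (fib h) ⟩
    fib (suc h) * fib i + fib h * fib i      ≤⟨ +-mono-≤ (fib-*-≤ (suc h) i) (fib-*-≤ h i) ⟩
    fib (4 + h + i)                          ∎
    where open ≤-Reasoning

open Natural
open import Data.Integer.Base as ℤ using (+_; _+_; _*_; _-_)
open import Data.Integer.Properties using (pos-*)
open import Data.Integer.Tactic.RingSolver using (solve-∀)
open import Data.Rational.Base as ℚ using (½; _/_; toℚᵘ)
import Data.Rational.Properties as ℚ
open import Data.Rational.Unnormalised.Base as ℚᵘ using (mkℚᵘ; *≡*)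
import Data.Rational.Unnormalised.Properties as ℚᵘ

-- Passage from ℕ to ℤ and ℚ.

halve : ∀ n x y → + 2 * n ≡ x - y → n / 1 ≡ ½ ℚ.* (x / 1) ℚ.- ½ ℚ.* (y / 1)
halve n x y 2n≡x-y = ℚ.toℚᵘ-injective (begin
  toℚᵘ (n / 1)                                              ≈⟨ ℚ.toℚᵘ-fromℚᵘ (mkℚᵘ n 0) ⟩
  mkℚᵘ n 0                                                  ≈⟨ *≡* cross ⟩
  toℚᵘ ½ ℚᵘ.* mkℚᵘ x 0 ℚᵘ.- toℚᵘ ½ ℚᵘ.* mkℚᵘ y 0            ≈⟨ ℚᵘ.+-cong (half x) (ℚᵘ.-‿cong (half y)) ⟨
  toℚᵘ (½ ℚ.* (x / 1)) ℚᵘ.- toℚᵘ (½ ℚ.* (y / 1))            ≈⟨ ℚᵘ.+-congʳ (toℚᵘ (½ ℚ.* (x / 1))) (ℚ.toℚᵘ-homo‿- (½ ℚ.* (y / 1))) ⟨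
  toℚᵘ (½ ℚ.* (x / 1)) ℚᵘ.+ toℚᵘ (ℚ.- (½ ℚ.* (y / 1)))      ≈⟨ ℚ.toℚᵘ-homo-+ (½ ℚ.* (x / 1)) (ℚ.- (½ ℚ.* (y / 1))) ⟨
  toℚᵘ (½ ℚ.* (x / 1) ℚ.- ½ ℚ.* (y / 1))                    ∎)
  where
  open ℚᵘ.≃-Reasoning
  half : ∀ z → toℚᵘ (½ ℚ.* (z / 1)) ℚᵘ.≃ toℚᵘ ½ ℚᵘ.* mkℚᵘ z 0
  half z = ℚᵘ.≃-trans (ℚ.toℚᵘ-homo-* ½ (z / 1)) (ℚᵘ.*-congˡ {toℚᵘ ½} (ℚ.toℚᵘ-fromℚᵘ (mkℚᵘ z 0)))
  double : ∀ n → n * + 4 ≡ + 2 * (+ 2 * n)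
  double = solve-∀
  spread : ∀ x y → + 2 * (x - y) ≡ (+ 1 * x * + 2 + ℤ.- (+ 1 * y) * + 2) * + 1
  spread = solve-∀
  -- The unnormalised difference of two fractions with denominator 2 has denominator 4, so
  -- cross-multiplying gives twice the hypothesis.
  cross : n * + 4 ≡ (+ 1 * x * + 2 + ℤ.- (+ 1 * y) * + 2) * + 1
  cross = trans (double n) (trans (cong (+ 2 *_) 2n≡x-y) (spread x y))

-- The hypothesis is the conclusion with every subtracted term moved to the other side.
formula-in-ℤ : ∀ N A B q s p r →
  2 ℕ.* N ℕ.+ s ℕ.* (q ℕ.* (p ℕ.* suc p) ℕ.+ 2 ℕ.* r ℕ.* A) ℕ.+ A ℕ.+ B
    ≡ A ℕ.* B ℕ.+ 1 ℕ.+ 2 ℕ.* (B ℕ.* (p ℕ.* q)) ℕ.+ s ℕ.* (q ℕ.* (r ℕ.* suc r)) →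
  + 2 * + N ≡ ((+ A + + 2 * + p * + q - + 1) * + B - + A + + 1)
    - (+ 2 * + r * + A - (+ r + + p + + 1) * (+ r - + p) * + q) * + s
formula-in-ℤ N A B q s p r eq = trans
  (isolate (+ N) (+ s * (+ q * (+ p * (+ 1 + + p)) + + 2 * + r * + A)) (+ A) (+ B))
  (trans (cong (_- (+ s * (+ q * (+ p * (+ 1 + + p)) + + 2 * + r * + A) + + A + + B)) lhs≡rhs)
    (expand (+ A) (+ B) (+ q) (+ s) (+ p) (+ r)))
  where
  pos-*-* : ∀ a b c → + (a ℕ.* (b ℕ.* c)) ≡ + a * (+ b * + c)
  pos-*-* a b c = trans (pos-* a _) (cong (+ a *_) (pos-* b c))
  lhs≡rhs : + 2 * + N + + s * (+ q * (+ p * (+ 1 + + p)) + + 2 * + r * + A) + + A + + B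
    ≡ + A * + B + + 1 + + 2 * (+ B * (+ p * + q)) + + s * (+ q * (+ r * (+ 1 + + r)))
  lhs≡rhs = trans
    (sym (cong₂ (λ a b → a + b + + A + + B) (pos-* 2 N)
      (trans (pos-* s _) (cong (+ s *_) (cong₂ _+_ (pos-*-* q p (suc p))
        (trans (pos-* (2 ℕ.* r) A) (cong (_* + A) (pos-* 2 r))))))))
    (trans (cong +_ eq)
      (cong₂ _+_
        (cong₂ (λ a b → a + + 1 + b) (pos-* A B)
          (trans (pos-* 2 (B ℕ.* (p ℕ.* q))) (cong (+ 2 *_) (pos-*-* B p q))))
        (trans (pos-* s _) (cong (+ s *_) (pos-*-* q r (suc r))))))
  isolate : ∀ N c A B → + 2 * N ≡ + 2 * N + c + A + B - (c + A + B)
  isolate = solve-∀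
  expand : ∀ A B q s p r →
    A * B + + 1 + + 2 * (B * (p * q)) + s * (q * (r * (+ 1 + r)))
      - (s * (q * (p * (+ 1 + p)) + + 2 * r * A) + A + B)
    ≡ ((A + + 2 * p * q - + 1) * B - A + + 1)
      - (+ 2 * r * A - (r + p + + 1) * (r - p) * q) * s
  expand = solve-∀

theorem13 : (i k p : ℕ) → 3 ≤ i → (3≤k : 3 ≤ k) →
    let r = ℕ._/_ (fib i ∸ 1) (fib k) {{fib-nonZero 3≤k}}
        F = λ (n : ℕ) → + fib n
    in p ≤ r →
    ∃[ N ] SylvesterNumber p (fib i ∷ fib (i ℕ.+ 2) ∷ fib (i ℕ.+ k) ∷ []) N
      × + N / 1 ≡
          ½ ℚ.* (((F i + + 2 * + p * F k - + 1) * F (i ℕ.+ 2) - F i + + 1) / 1)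
          ℚ.- ½ ℚ.* (((+ 2 * + r * F i - (+ r + + p + + 1) * (+ r - + p) * F k) * F (k ∸ 2)) / 1)
theorem13 i@(suc n) k@(suc (suc h)) p 3≤i 3≤k@(s≤s (s≤s _)) p≤r =
  N , sylvester ,
  halve (+ N)
    ((+ A + + 2 * + p * + q - + 1) * + B - + A + + 1)
    ((+ 2 * + r * + A - (+ r + + p + + 1) * (+ r - + p) * + q) * + fib h)
    (formula-in-ℤ N A B q (fib h) p r (sylvester-formula r u rq+u≡A (ℕ.m%n<n (A ∸ 1) q)))
  where
  A B q r u : ℕ
  A = fib i
  B = fib (i ℕ.+ 2)
  q = fib k
  instance
    A≢0 : NonZero A
    A≢0 = fib-nonZero 3≤i
    B≢0 : NonZero B
    B≢0 = fib-suc-nonZero (n ℕ.+ 2)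
    q≢0 : NonZero q
    q≢0 = fib-nonZero 3≤k
  r = (A ∸ 1) ℕ./ q
  -- Since r is the quotient of A - 1 and not of A, the rest A - rq lies in 1, ..., q. It equals q
  -- when q divides A.
  u = suc ((A ∸ 1) ℕ.% q)
  rq+u≡A : r ℕ.* q ℕ.+ u ≡ A
  rq+u≡A = trans (ℕ.+-comm _ u) (trans (cong suc (sym (ℕ.m≡m%n+[m/n]*n (A ∸ 1) q))) (ℕ.suc-pred A))
  2+i≡i+2 : 2 ℕ.+ i ≡ i ℕ.+ 2
  2+i≡i+2 = ℕ.+-comm 2 i
  k+i≡i+k : k ℕ.+ i ≡ i ℕ.+ k
  k+i≡i+k = ℕ.+-comm k i
  open ThreeGenerators A B (fib (i ℕ.+ k)) q (fib h) p
    (subst (λ n → Coprime A (fib n)) 2+i≡i+2 (fib-coprime-2+ i))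
    (trans (cong (λ n → fib n ℕ.+ fib h ℕ.* A) (sym k+i≡i+k))
      (trans (fib-2+h+i h i) (cong (λ n → q ℕ.* fib n) 2+i≡i+2)))
    (subst (λ n → fib h ℕ.* A ≤ fib n) k+i≡i+k (fib-*-≤ h i))
    (ℕ.≤-trans (ℕ.*-monoˡ-≤ q p≤r) (subst (r ℕ.* q ≤_) rq+u≡A (ℕ.m≤m+n _ u)))
  N : ℕ
  N = ∑ A Class.count
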